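{- The age of $\omega*I_\omega^*$ has the expansion property relative to the age of $\omega*I_\omega$.
   Context: In a directed graph, write $x\perp y$ iff neither $(x,y)$ nor $(y,x)$ is an edge. $\omega*I_\omega$ is the Fraïssé limit of the class of all finite directed graphs in which $\perp$ is an equivalence relation (classes called parts). $\omega*I_\omega^*$ is obtained by adding a linear order $<$ convex with respect to the parts, ordering each part densely and the set of parts densely; its age consists of all finite such directed graphs with a linear order convex with respect to the parts. If $\mathcal K^*$ is a class of expansions of members of $\mathcal K$, it has the expansion property relative to $\mathcal K$ if for every $\mathbf A\in\mathcal K$ there is $\mathbf B\in\mathcal K$ such that every expansion of $\mathbf A$ in $\mathcal K^*$ embeds in every expansion of $\mathbf B$ in $\mathcal K^*$. -}

module Defs where

open import Data.Nat using (ℕ)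
open import Data.Fin using (Fin)
open import Data.Bool using (Bool; true; false)
open import Data.Product using (Σ; _×_)
open import Data.Sum using (_⊎_)
open import Relation.Binary.PropositionalEquality using (_≡_; _≢_)
open import Function.Definitions using (Injective)

Rel₂ : ℕ → Set
Rel₂ n = Fin n → Fin n → Bool

-- Directed graph (Cherlin's convention: loopless and no 2-cycles, i.e.
-- an irreflexive asymmetric edge relation).
IsDigraph : {n : ℕ} → Rel₂ n → Set
IsDigraph {n} E =
  ((x : Fin n) → E x x ≡ false) ×
  ((x y : Fin n) → E x y ≡ true → E y x ≡ false)

Perp : {n : ℕ} → Rel₂ n → Fin n → Fin n → Set
Perp E x y = (E x y ≡ false) × (E y x ≡ false)

PerpEquivalence : {n : ℕ} → Rel₂ n → Set
PerpEquivalence {n} E =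
  ((x : Fin n) → Perp E x x) ×
  ((x y : Fin n) → Perp E x y → Perp E y x) ×
  ((x y z : Fin n) → Perp E x y → Perp E y z → Perp E x z)

-- Age of ω*I_ω: finite directed graphs in which ⊥ is an equivalence relation.
InAge : {n : ℕ} → Rel₂ n → Set
InAge E = IsDigraph E × PerpEquivalence E

IsStrictLinearOrder : {n : ℕ} → Rel₂ n → Set
IsStrictLinearOrder {n} L =
  ((x : Fin n) → L x x ≡ false) ×
  ((x y z : Fin n) → L x y ≡ true → L y z ≡ true → L x z ≡ true) ×
  ((x y : Fin n) → x ≢ y → (L x y ≡ true) ⊎ (L y x ≡ true))

ConvexParts : {n : ℕ} → Rel₂ n → Rel₂ n → Set
ConvexParts {n} E L =
  (x y z : Fin n) → L x y ≡ true → L y z ≡ true → Perp E x z → Perp E x y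

-- (E , L) is an expansion of E lying in the age of ω*I_ω^*.
IsStarExpansion : {n : ℕ} → Rel₂ n → Rel₂ n → Set
IsStarExpansion E L = IsStrictLinearOrder L × ConvexParts E L

IsEmbedding : {m n : ℕ} → Rel₂ m → Rel₂ m → Rel₂ n → Rel₂ n → (Fin m → Fin n) → Set
IsEmbedding {m} EA LA EB LB f =
  Injective _≡_ _≡_ f ×
  ((x y : Fin m) → EB (f x) (f y) ≡ EA x y) ×
  ((x y : Fin m) → LB (f x) (f y) ≡ LA x y)

Embeds : {m n : ℕ} → Rel₂ m → Rel₂ m → Rel₂ n → Rel₂ n → Set
Embeds {m} {n} EA LA EB LB = Σ (Fin m → Fin n) (IsEmbedding EA LA EB LB)

ExpansionProperty : Set
ExpansionProperty =
  (m : ℕ) (A : Rel₂ m) → InAge A →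
  Σ ℕ λ n → Σ (Rel₂ n) λ B → InAge B ×
    ((LA : Rel₂ m) → IsStarExpansion A LA →
     (LB : Rel₂ n) → IsStarExpansion B LB →
     Embeds A LA B LB)

{-# OPTIONS --safe #-}

-- The structure B is built by iterating a step that allows one more part,
-- with at most l points.  From a structure S, take three blow-ups of S,
-- arranged in a 3-cycle, every point of S being replaced by pairs (i , p) of
-- words of length l, whose letters carry types over S (subsets of S).  In any
-- convex order, let c be the blow-up whose maximum is least: the last part of
-- the next blow-up then lies above all of c, and it contains a full set of
-- words p.  A point with word p realises over the copy of S with word i in c
-- the type carried by the first letter of p that differs from i.  Whatever the
-- order on words, some i is such that every sequence of l types over the i-th
-- copy is realised by an increasing sequence of words.
module Submission where

open import Defs
open import Data.Bool using (Bool; true; false; not; _∧_)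
open import Data.Bool.Properties as Bool using (not-¬; not-involutive)
open import Data.Fin using (Fin; zero; suc)
open import Data.Fin.Patterns using (0F; 1F; 2F)
import Data.Fin.Properties as Fin
open import Data.Nat using (ℕ; zero; suc; _≤_; _<_; z≤n; s≤s; _<?_)
open import Data.Nat.Properties as ℕ using (<-cmp; <-irrefl; ≤-trans; <-trans; ≤-antisym)
open import Data.Product using (Σ; ∃; _×_; _,_; proj₁; proj₂; uncurry)
open import Data.Product.Function.NonDependent.Propositional using (_×-↔_)
open import Data.Sum using (_⊎_; inj₁; inj₂)
open import Data.Unit using (⊤; tt)
open import Data.Vec using (Vec; []; _∷_; lookup; tabulate; replicate; uncons)
open import Data.Vec.Properties using (lookup∘tabulate)
open import Function using (_∘_; flip)
open import Function.Bundles using (_↔_; Inverse; mk↔ₛ′)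
open import Function.Properties.Inverse using (↔⇒↣; ↔-refl; ↔-sym; ↔-trans)
open import Relation.Binary.Definitions using (DecidableEquality; Reflexive; Transitive; Total; tri<; tri≈; tri>)
open import Relation.Binary.PropositionalEquality using (_≡_; _≢_; refl; sym; trans; cong; cong₂; subst; ≢-sym)
open import Relation.Nullary using (¬_; Dec; yes; no; does; contradiction)
open import Relation.Nullary.Decidable using (via-injection; _×-dec_; dec-true; dec-false)

-- Finite types

record Finite (X : Set) : Set where
  constructor finite
  field
    {size}    : ℕ
    enumerate : Fin size ↔ X
  open Inverse enumerate public using () renaming (to to elem; from to index; strictlyInverseˡ to elem-index)

  index-injective : ∀ {x y} → index x ≡ index y → x ≡ y
  index-injective {x} {y} eq = trans (sym (elem-index x)) (trans (cong elem eq) (elem-index y))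

  _≟_ : DecidableEquality X
  _≟_ = via-injection (↔⇒↣ (↔-sym enumerate)) Fin._≟_

fin-finite : ∀ n → Finite (Fin n)
fin-finite n = finite ↔-refl

bool-finite : Finite Bool
bool-finite = finite Fin.2↔Bool

⊤-finite : Finite ⊤
⊤-finite = finite Fin.1↔⊤

abstract
  _×-finite_ : ∀ {X Y} → Finite X → Finite Y → Finite (X × Y)
  finite f ×-finite finite g = finite (↔-trans Fin.*↔× (f ×-↔ g))

  vec-finite : ∀ {X} → Finite X → ∀ n → Finite (Vec X n)
  vec-finite X-finite zero = finite (↔-trans Fin.1↔⊤ (mk↔ₛ′ (λ _ → []) (λ _ → tt) (λ { [] → refl }) (λ _ → refl)))
  vec-finite X-finite (suc n) = finite (↔-trans (Finite.enumerate (X-finite ×-finite vec-finite X-finite n)) cons)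
    where
    cons : ∀ {A : Set} → (A × Vec A n) ↔ Vec A (suc n)
    cons = mk↔ₛ′ (uncurry _∷_) uncons (λ { (x ∷ xs) → refl }) (λ { (x , xs) → refl })

module Greatest {X : Set} (_⊑_ : X → X → Set) (⊑-refl : Reflexive _⊑_) (⊑-trans : Transitive _⊑_) (⊑-total : Total _⊑_) where

  greatest-fin : ∀ n (g : Fin (suc n) → X) → ∃ λ i → ∀ j → g j ⊑ g i
  greatest-fin zero    g = zero , λ { zero → ⊑-refl }
  greatest-fin (suc n) g with greatest-fin n (g ∘ suc)
  ... | i , g⊑gi with ⊑-total (g zero) (g (suc i))
  ... | inj₁ g0⊑gi = suc i , λ { zero → g0⊑gi ; (suc j) → g⊑gi j }
  ... | inj₂ gi⊑g0 = zero , λ { zero → ⊑-refl ; (suc j) → ⊑-trans (g⊑gi j) gi⊑g0 }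

  greatest : ∀ {Y} → Finite Y → Y → (g : Y → X) → ∃ λ y → ∀ y′ → g y′ ⊑ g y
  greatest {Y} (finite {zero}  Y-enum) y₀ g with () ← Inverse.from Y-enum y₀
  greatest {Y} (finite {suc n} Y-enum) y₀ g =
    elem (proj₁ top) , λ y′ → subst (λ z → g z ⊑ g (elem (proj₁ top))) (elem-index y′) (proj₂ top (index y′))
    where
    open Finite (finite Y-enum)
    top = greatest-fin n (g ∘ elem)

-- Linear orders

BoolRel : Set → Set
BoolRel X = X → X → Bool

record StrictLinear {X : Set} (L : BoolRel X) : Set where
  field
    irrefl     : ∀ x → L x x ≡ false
    transitive : ∀ x y z → L x y ≡ true → L y z ≡ true → L x z ≡ true
    total      : ∀ x y → x ≢ y → L x y ≡ true ⊎ L y x ≡ true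

  asym : ∀ x y → L x y ≡ true → L y x ≡ false
  asym x y x<y with L y x in y<x
  ... | false = refl
  ... | true  = trans (sym (transitive x y x x<y y<x)) (irrefl x)

  <⇒≢ : ∀ {x y} → L x y ≡ true → x ≢ y
  <⇒≢ {x} x<x refl with () ← trans (sym x<x) (irrefl x)

pullback-linear : ∀ {X Y} {L : BoolRel Y} (g : X → Y) → (∀ {x y} → g x ≡ g y → x ≡ y) →
                  StrictLinear L → StrictLinear (λ x y → L (g x) (g y))
pullback-linear g g-inj lin = record
  { irrefl     = λ x → irrefl (g x)
  ; transitive = λ x y z → transitive (g x) (g y) (g z)
  ; total      = λ x y x≢y → total (g x) (g y) (x≢y ∘ g-inj)
  }
  where open StrictLinear lin

module _ {X : Set} {L : BoolRel X} (L-linear : StrictLinear L) (_≟_ : DecidableEquality X) where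
  open StrictLinear L-linear

  private
    _⊑_ : X → X → Set
    x ⊑ y = x ≡ y ⊎ L x y ≡ true

    ⊑-trans : Transitive _⊑_
    ⊑-trans (inj₁ refl) q           = q
    ⊑-trans (inj₂ p)    (inj₁ refl) = inj₂ p
    ⊑-trans (inj₂ p)    (inj₂ q)    = inj₂ (transitive _ _ _ p q)

    ⊑-total : Total _⊑_
    ⊑-total x y with x ≟ y
    ... | yes x≡y = inj₁ (inj₁ x≡y)
    ... | no  x≢y with total x y x≢y
    ... | inj₁ x<y = inj₁ (inj₂ x<y)
    ... | inj₂ y<x = inj₂ (inj₂ y<x)

    module Max = Greatest _⊑_ (inj₁ refl) ⊑-trans ⊑-total
    module Min = Greatest (flip _⊑_) (inj₁ refl) (flip ⊑-trans) (flip ⊑-total)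

  abstract
    -- The class whose maximum is least works: its points lie at or below that maximum, hence at or
    -- below the maximum of any other class, and equality is impossible because a value of `g`
    -- determines its class.
    least-maximum : ∀ {C Y} → Finite C → C → Finite Y → Y →
                    (g : C → Y → X) → (∀ {c c′ y y′} → g c y ≡ g c′ y′ → c ≡ c′) →
                    Σ C λ c → Σ (C → Y) λ top → ∀ c′ → c′ ≢ c → ∀ y → L (g c y) (g c′ (top c′)) ≡ true
    least-maximum {C} {Y} C-finite c₀ Y-finite y₀ g g-inj = c , top , above
      where
      maximum : ∀ c → ∃ λ y → ∀ y′ → g c y′ ⊑ g c y
      maximum c = Max.greatest Y-finite y₀ (g c)

      top : C → Y
      top c = proj₁ (maximum c)

      minimum : ∃ λ c → ∀ c′ → g c (top c) ⊑ g c′ (top c′)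
      minimum = Min.greatest C-finite c₀ (λ c → g c (top c))

      c : C
      c = proj₁ minimum

      above : ∀ c′ → c′ ≢ c → ∀ y → L (g c y) (g c′ (top c′)) ≡ true
      above c′ c′≢c y with ⊑-trans (proj₂ (maximum c) y) (proj₂ minimum c′)
      ... | inj₁ eq  = contradiction (sym (g-inj eq)) c′≢c
      ... | inj₂ y<t = y<t

-- Words

module Words {R : Set} (R-finite : Finite R) (r₀ : R) where

  Letter : Set
  Letter = Bool × R

  letter-finite : Finite Letter
  letter-finite = bool-finite ×-finite R-finite

  open Finite letter-finite using () renaming (_≟_ to _≟ₗ_)

  Word : ℕ → Set
  Word = Vec Letter

  word-finite : ∀ l → Finite (Word l)
  word-finite = vec-finite letter-finite

  someWord : ∀ l → Word l
  someWord l = replicate l (true , r₀)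

  -- Only the first word supplies the type, so against a fixed `i` a word can carry any type and can
  -- leave `i` at any position. Equal words get the default `r₀`.
  firstDifference : ∀ {l} → Word l → Word l → R
  firstDifference [] [] = r₀
  firstDifference (a ∷ p) (b ∷ i) with a ≟ₗ b
  ... | yes _ = firstDifference p i
  ... | no  _ = proj₂ a

  firstDifference-≡ : ∀ {l} a (p i : Word l) → firstDifference (a ∷ p) (a ∷ i) ≡ firstDifference p i
  firstDifference-≡ a p i with a ≟ₗ a
  ... | yes _   = refl
  ... | no  a≢a = contradiction refl a≢a

  firstDifference-≢ : ∀ {l} {a b} (p i : Word l) → a ≢ b → firstDifference (a ∷ p) (b ∷ i) ≡ proj₂ a
  firstDifference-≢ {a = a} {b} p i a≢b with a ≟ₗ b
  ... | yes a≡b = contradiction a≡b a≢b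
  ... | no  _   = refl

  -- Points with `σ x` at least `l` stay unconstrained, so an induction on `l` can keep `M`, `σ` and
  -- `s` fixed.
  Realises : ∀ {l} → BoolRel (Word l) → Word l → {M : Set} → (M → ℕ) → (M → R) → Set
  Realises {l} L i {M} σ s =
    Σ (M → Word l) λ y →
      (∀ x → σ x < l → firstDifference (y x) i ≡ s x) ×
      (∀ x x′ → σ x < σ x′ → σ x′ < l → L (y x) (y x′) ≡ true)

  -- Induction on `l`. The first letter `c` is the one whose class of words has the least maximum.
  -- Points of rank below `l` are served inside that class by the induction hypothesis; a point of
  -- rank `l` takes another letter carrying its type, completed to a word above the whole class of
  -- `c`. The choice depends on `L` alone, so one word serves all `σ` and `s`.
  realising-word : ∀ l (L : BoolRel (Word l)) → StrictLinear L →
                   Σ (Word l) λ i → ∀ {M : Set} (σ : M → ℕ) (s : M → R) → Realises L i σ s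
  realising-word zero    L lin = [] , λ σ s → (λ _ → []) , (λ _ ()) , (λ _ _ _ ())
  realising-word (suc l) L lin
    with least-maximum lin (Finite._≟_ (word-finite (suc l))) letter-finite (true , r₀)
           (word-finite l) (someWord l) _∷_ (λ { refl → refl })
  ... | c@(b , _) , top , above
    with realising-word l (λ p q → L (c ∷ p) (c ∷ q)) (pullback-linear (c ∷_) (λ { refl → refl }) lin)
  ... | i , realise = c ∷ i , realise′
    where
    realise′ : ∀ {M : Set} (σ : M → ℕ) (s : M → R) → Realises L (c ∷ i) σ s
    realise′ {M} σ s with realise σ s
    ... | y , y-type , y-mono = y′ , y′-type , y′-mono
      where
      -- The Boolean component provides, for every type, a letter other than c.
      other : M → Letter
      other x = not b , s x

      other≢c : ∀ x → other x ≢ c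
      other≢c x eq = not-¬ refl (sym (cong proj₁ eq))

      y′ : M → Word (suc l)
      y′ x with σ x <? l
      ... | yes _ = c ∷ y x
      ... | no  _ = other x ∷ top (other x)

      y′-type : ∀ x → σ x < suc l → firstDifference (y′ x) (c ∷ i) ≡ s x
      y′-type x _ with σ x <? l
      ... | yes σx<l = trans (firstDifference-≡ c (y x) i) (y-type x σx<l)
      ... | no  _    = firstDifference-≢ (top (other x)) i (other≢c x)

      y′-mono : ∀ x x′ → σ x < σ x′ → σ x′ < suc l → L (y′ x) (y′ x′) ≡ true
      y′-mono x x′ σ< (s≤s σx′≤l) with σ x <? l | σ x′ <? l
      ... | yes _   | yes σx′<l = y-mono x x′ σ< σx′<l
      ... | yes _   | no  _     = above (other x′) (other≢c x′) (y x)
      ... | no  σ≮l | _         = contradiction (≤-trans σ< σx′≤l) σ≮l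

-- Multipartite digraphs and convex orders

Perpendicular : {X : Set} → BoolRel X → X → X → Set
Perpendicular E x y = E x y ≡ false × E y x ≡ false

-- This is `InAge` over an arbitrary carrier: reflexivity of perpendicularity comes from `irrefl`,
-- its symmetry from exchanging the two components.
record Multipartite {X : Set} (E : BoolRel X) : Set where
  field
    irrefl     : ∀ x → E x x ≡ false
    asym       : ∀ x y → E x y ≡ true → E y x ≡ false
    perp-trans : ∀ x y z → Perpendicular E x y → Perpendicular E y z → Perpendicular E x z

record ConvexOrder {X : Set} (E L : BoolRel X) : Set where
  field
    linear : StrictLinear L
    convex : ∀ x y z → L x y ≡ true → L y z ≡ true → Perpendicular E x z → Perpendicular E x y
  open StrictLinear linear public

pullback-convex : ∀ {X Y} {D : BoolRel X} {E L : BoolRel Y} (g : X → Y) → (∀ {x y} → g x ≡ g y → x ≡ y) →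
                  (∀ x y → E (g x) (g y) ≡ D x y) → ConvexOrder E L → ConvexOrder D (λ x y → L (g x) (g y))
pullback-convex {D = D} {E} g g-inj g-edge ord = record
  { linear = pullback-linear g g-inj linear
  ; convex = λ x y z x<y y<z (xz , zx) →
      let xy , yx = convex (g x) (g y) (g z) x<y y<z (trans (g-edge x z) xz , trans (g-edge z x) zx)
      in trans (sym (g-edge x y)) xy , trans (sym (g-edge y x)) yx
  }
  where open ConvexOrder ord

record Structure : Set₁ where
  field
    {Carrier}      : Set
    carrier-finite : Finite Carrier
    point          : Carrier
    E              : BoolRel Carrier
    multipartite   : Multipartite E

-- ρ ranks the parts (not necessarily by consecutive numbers), σ the points.
record Ranking {m} (l : ℕ) (A : Rel₂ m) : Set where
  field
    ρ σ         : Fin m → ℕ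
    σ-bounded   : ∀ x → σ x < l
    σ-injective : ∀ {x y} → σ x ≡ σ y → x ≡ y
    ρ<⇒σ<       : ∀ {x y} → ρ x < ρ y → σ x < σ y
    ρ≡⇒false    : ∀ {x y} → ρ x ≡ ρ y → A x y ≡ false
    ρ<⇒not      : ∀ {x y} → ρ x < ρ y → A y x ≡ not (A x y)

-- The map is total but constrained only on parts ranked below `k`, which permits induction on `k`.
-- The number of points is bounded by `l` through `σ`. Injectivity on the constrained points follows
-- from the order clause.
Universal : Structure → ℕ → ℕ → Set
Universal S l k =
  ∀ L → ConvexOrder E L → ∀ {m} {A : Rel₂ m} (rank : Ranking l A) → let open Ranking rank in
  Σ (Fin m → Carrier) λ f → ∀ x y → ρ x < k → ρ y < k →
    E (f x) (f y) ≡ A x y × (σ x < σ y → L (f x) (f y) ≡ true)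
  where open Structure S

-- Three copies in a cycle

data Arc : Set where
  same forward backward : Arc

-- The cyclic tournament on three vertices. The order decides which copy has the least maximum, so
-- every copy needs an out-neighbour; three is the least size of a tournament with this property.
arc : Fin 3 → Fin 3 → Arc
arc 0F 0F = same
arc 0F 1F = forward
arc 0F 2F = backward
arc 1F 0F = backward
arc 1F 1F = same
arc 1F 2F = forward
arc 2F 0F = forward
arc 2F 1F = backward
arc 2F 2F = same

next : Fin 3 → Fin 3
next 0F = 1F
next 1F = 2F
next 2F = 0F

next≢ : ∀ c → next c ≢ c
next≢ 0F ()
next≢ 1F ()
next≢ 2F ()

arc-next : ∀ c → arc c (next c) ≡ forward
arc-next 0F = refl
arc-next 1F = refl
arc-next 2F = refl

arc-refl : ∀ c → arc c c ≡ same
arc-refl 0F = refl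
arc-refl 1F = refl
arc-refl 2F = refl

arc-cases : ∀ c c′ → c ≢ c′ → (arc c c′ ≡ forward × arc c′ c ≡ backward) ⊎ (arc c c′ ≡ backward × arc c′ c ≡ forward)
arc-cases 0F 0F c≢c = contradiction refl c≢c
arc-cases 0F 1F _   = inj₁ (refl , refl)
arc-cases 0F 2F _   = inj₂ (refl , refl)
arc-cases 1F 0F _   = inj₂ (refl , refl)
arc-cases 1F 1F c≢c = contradiction refl c≢c
arc-cases 1F 2F _   = inj₁ (refl , refl)
arc-cases 2F 0F _   = inj₁ (refl , refl)
arc-cases 2F 1F _   = inj₂ (refl , refl)
arc-cases 2F 2F c≢c = contradiction refl c≢c

module Step (l : ℕ) (S : Structure) where
  open Structure S
  open Finite carrier-finite using (size; elem; index; elem-index; _≟_)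
  private module S = Multipartite multipartite

  -- Subsets of `Carrier` as bit vectors, so that types form a finite set and can be carried by
  -- letters.
  Type : Set
  Type = Vec Bool size

  _at_ : Type → Carrier → Bool
  t at h = lookup t (index h)

  comprehension : (Carrier → Bool) → Type
  comprehension P = tabulate (P ∘ elem)

  comprehension-at : ∀ P h → comprehension P at h ≡ P h
  comprehension-at P h = trans (lookup∘tabulate (P ∘ elem) (index h)) (cong P (elem-index h))

  open Words (vec-finite bool-finite size) (replicate size false)

  -- In `(c , i , h , p)` the word `i` is what vertices of the next copy are compared with, and `p`
  -- selects the type over the preceding copy. The part depends only on `c` and the part of `h`;
  -- both words vary freely inside it.
  Vertex : Set
  Vertex = Fin 3 × Word l × Carrier × Word l

  vertex-finite : Finite Vertex
  vertex-finite = fin-finite 3 ×-finite (word-finite l ×-finite (carrier-finite ×-finite word-finite l))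

  edgeAlong : Arc → Word l × Carrier × Word l → Word l × Carrier × Word l → Bool
  edgeAlong same     (i , h , p) (i′ , h′ , p′) = E h h′
  edgeAlong forward  (i , h , p) (i′ , h′ , p′) = firstDifference p′ i at h
  edgeAlong backward (i , h , p) (i′ , h′ , p′) = not (firstDifference p i′ at h′)

  edge : BoolRel Vertex
  edge (c , v) (c′ , v′) = edgeAlong (arc c c′) v v′

  edge-within : ∀ c v v′ → edge (c , v) (c , v′) ≡ E (proj₁ (proj₂ v)) (proj₁ (proj₂ v′))
  edge-within c v v′ rewrite arc-refl c = refl

  edge-across : ∀ {c c′} v v′ → c ≢ c′ → edge (c′ , v′) (c , v) ≡ not (edge (c , v) (c′ , v′))
  edge-across {c} {c′} v v′ c≢c′ with arc-cases c c′ c≢c′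
  ... | inj₁ (p , q) rewrite p | q = refl
  ... | inj₂ (p , q) rewrite p | q = sym (not-involutive _)

  -- Between different copies exactly one direction is an edge, so no part meets two copies.
  perp⇒≡ : ∀ c c′ v v′ → Perpendicular edge (c , v) (c′ , v′) → c ≡ c′
  perp⇒≡ c c′ v v′ (p , q) with c Fin.≟ c′
  ... | yes c≡c′ = c≡c′
  ... | no  c≢c′ with () ← trans (sym q) (trans (edge-across v v′ c≢c′) (cong not p))

  edge-multipartite : Multipartite edge
  edge-multipartite = record
    { irrefl     = λ { (c , v) → trans (edge-within c v v) (S.irrefl _) }
    ; asym       = asym
    ; perp-trans = perp-trans
    }
    where
    asym : ∀ x y → edge x y ≡ true → edge y x ≡ false
    asym (c , v) (c′ , v′) e with c Fin.≟ c′
    ... | yes refl = trans (edge-within c v′ v) (S.asym _ _ (trans (sym (edge-within c v v′)) e))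
    ... | no  c≢c′ = trans (edge-across v v′ c≢c′) (cong not e)

    perp-trans : ∀ x y z → Perpendicular edge x y → Perpendicular edge y z → Perpendicular edge x z
    perp-trans (c , u) (c′ , v) (c″ , w) x⊥y y⊥z with perp⇒≡ c c′ u v x⊥y | perp⇒≡ c′ c″ v w y⊥z
    ... | refl | refl =
      trans (edge-within c u w) (proj₁ u⊥w) , trans (edge-within c w u) (proj₂ u⊥w)
      where
      down : ∀ {v v′} → Perpendicular edge (c , v) (c , v′) → Perpendicular E (proj₁ (proj₂ v)) (proj₁ (proj₂ v′))
      down {v} {v′} (p , q) = trans (sym (edge-within c v v′)) p , trans (sym (edge-within c v′ v)) q

      u⊥w = S.perp-trans _ _ _ (down {u} {v} x⊥y) (down {v} {w} y⊥z)

  step : Structure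
  step = record
    { carrier-finite = vertex-finite
    ; point          = 0F , someWord l , point , someWord l
    ; E              = edge
    ; multipartite   = edge-multipartite
    }

  -- Parts ranked below `k` go into a copy of `S` inside `c`, the part ranked `k` into one fibre of
  -- the next copy. The word `i` depends only on the order of that fibre and is fixed first; it
  -- selects the copy of `S`, whose embedding `f` then determines the types. Hence `realising-word`
  -- has to be uniform in the types.
  step-universal : ∀ {k} → Universal S l k → Universal step l (suc k)
  step-universal {k} universal L ord {m} {A} rank
    with least-maximum (ConvexOrder.linear ord) (Finite._≟_ vertex-finite) (fin-finite 3) 0F
           (word-finite l ×-finite (carrier-finite ×-finite word-finite l)) (someWord l , point , someWord l)
           _,_ (cong proj₁)
  ... | c , top , above
    -- The vertex `top (next c)` lies above all of copy `c`; its coordinates `j` and `g` fix the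
    -- fibre for the new points.
    with j , g , q ← top (next c) in top≡
    with realising-word l (λ p p′ → L (next c , j , g , p) (next c , j , g , p′))
           (pullback-linear (λ p → next c , j , g , p) (cong (proj₂ ∘ proj₂ ∘ proj₂)) (ConvexOrder.linear ord))
  ... | i , realise
    -- The last coordinate `i` is an arbitrary filler: neither edges within `c` nor edges between
    -- `c` and `next c` read it on the side of `c`.
    with universal (λ h h′ → L (c , i , h , i) (c , i , h′ , i))
           (pullback-convex (λ h → c , i , h , i) (cong (proj₁ ∘ proj₂ ∘ proj₂)) (λ _ _ → edge-within c _ _) ord) rank
  ... | f , f-embeds = f′ , f′-embeds
    where
    open ConvexOrder ord
    open Ranking rank

    -- Only the word `q` is known to be above `v`. A fibre point below `v` would be perpendicular to
    -- the one at `q`, so convexity would put `v` into their part, which lies in another copy.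
    fibre-above : ∀ v p → L (c , v) (next c , j , g , p) ≡ true
    fibre-above v p with total (c , v) (next c , j , g , p) (λ eq → next≢ c (sym (cong proj₁ eq)))
    ... | inj₁ v<p = v<p
    ... | inj₂ p<v = contradiction (perp⇒≡ (next c) c (j , g , p) v p⊥v) (next≢ c)
      where
      v<q : L (c , v) (next c , j , g , q) ≡ true
      v<q = subst (λ w → L (c , v) (next c , w) ≡ true) top≡ (above (next c) (next≢ c) v)

      p⊥q : Perpendicular edge (next c , j , g , p) (next c , j , g , q)
      p⊥q = trans (edge-within (next c) _ _) (S.irrefl g) , trans (edge-within (next c) _ _) (S.irrefl g)

      p⊥v = convex _ _ _ p<v v<q p⊥q

    -- Needed for types: membership of `f x` in the type of `y` must reflect the edge from `x`
    -- itself, not from another point with the same image.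
    f-injective : ∀ {x y} → ρ x < k → ρ y < k → f x ≡ f y → x ≡ y
    f-injective {x} {y} x<k y<k eq with <-cmp (σ x) (σ y)
    ... | tri< lt _ _ = contradiction (cong (λ h → c , i , h , i) eq) (<⇒≢ (proj₂ (f-embeds x y x<k y<k) lt))
    ... | tri≈ _ σ≡ _ = σ-injective σ≡
    ... | tri> _ _ gt = contradiction (cong (λ h → c , i , h , i) (sym eq)) (<⇒≢ (proj₂ (f-embeds y x y<k x<k) gt))

    preimage? : ∀ y h → Dec (∃ λ x → f x ≡ h × ρ x < k × A x y ≡ true)
    preimage? y h = Fin.any? λ x → (f x ≟ h) ×-dec ((ρ x <? k) ×-dec (A x y Bool.≟ true))

    typeOf : Fin m → Type
    typeOf y = comprehension (does ∘ preimage? y)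

    typeOf-at : ∀ {x} y → ρ x < k → typeOf y at f x ≡ A x y
    typeOf-at {x} y x<k = trans (comprehension-at (does ∘ preimage? y) (f x)) decide
      where
      decide : does (preimage? y (f x)) ≡ A x y
      decide with A x y in Axy
      ... | true  = dec-true (preimage? y (f x)) (x , refl , x<k , Axy)
      ... | false = dec-false (preimage? y (f x)) λ (x′ , eq , x′<k , Ax′y) →
        not-¬ Axy (subst (λ z → A z y ≡ true) (f-injective x′<k x<k eq) Ax′y)

    w : Fin m → Word l
    w = proj₁ (realise σ typeOf)

    w-type : ∀ y → firstDifference (w y) i ≡ typeOf y
    w-type y = proj₁ (proj₂ (realise σ typeOf)) y (σ-bounded y)

    f′ : Fin m → Vertex
    f′ x with ρ x <? k
    ... | yes _ = c , i , f x , i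
    ... | no  _ = next c , j , g , w x

    edge-up : ∀ {x} y → ρ x < k → edge (c , i , f x , i) (next c , j , g , w y) ≡ A x y
    edge-up {x} y x<k rewrite arc-next c = trans (cong (_at f x) (w-type y)) (typeOf-at y x<k)

    f′-embeds : ∀ x y → ρ x < suc k → ρ y < suc k → edge (f′ x) (f′ y) ≡ A x y × (σ x < σ y → L (f′ x) (f′ y) ≡ true)
    f′-embeds x y (s≤s ρx≤k) (s≤s ρy≤k) with ρ x <? k | ρ y <? k
    ... | yes x<k | yes y<k = trans (edge-within c _ _) (proj₁ (f-embeds x y x<k y<k)) , proj₂ (f-embeds x y x<k y<k)
    ... | yes x<k | no  _   = edge-up y x<k , λ _ → fibre-above _ (w y)
    -- Here `y` is in an earlier part than `x`, so the order clause is vacuous and the edge is the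
    -- complement of the one already realised.
    ... | no  x≮k | yes y<k =
      trans (edge-across (i , f y , i) (j , g , w x) (≢-sym (next≢ c))) (trans (cong not (edge-up x y<k)) (sym (ρ<⇒not ρy<ρx))) ,
      λ σx<σy → contradiction (<-trans σx<σy (ρ<⇒σ< ρy<ρx)) (<-irrefl refl)
      where
      ρy<ρx = ≤-trans y<k (ℕ.≮⇒≥ x≮k)
    -- Both points have part rank exactly `k`; they share the coordinate `g`, and the realising
    -- words order them.
    ... | no  x≮k | no  y≮k =
      trans (edge-within (next c) _ _) (trans (S.irrefl g) (sym (ρ≡⇒false ρx≡ρy))) ,
      λ σx<σy → proj₂ (proj₂ (realise σ typeOf)) x y σx<σy (σ-bounded y)
      where
      ρx≡ρy = trans (≤-antisym ρx≤k (ℕ.≮⇒≥ x≮k)) (≤-antisym (ℕ.≮⇒≥ y≮k) ρy≤k)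

-- Iterating the step

singleton : Structure
singleton = record
  { carrier-finite = ⊤-finite
  ; point          = tt
  ; E              = λ _ _ → false
  ; multipartite   = record
    { irrefl     = λ _ → refl
    ; asym       = λ _ _ ()
    ; perp-trans = λ _ _ _ _ _ → refl , refl
    }
  }

tower : ℕ → ℕ → Structure
tower l zero    = singleton
tower l (suc k) = Step.step l (tower l k)

-- At height zero no part is constrained, so any nonempty structure can start the tower.
tower-universal : ∀ l k → Universal (tower l k) l k
tower-universal l zero    L ord rank = (λ _ → tt) , λ _ _ ()
tower-universal l (suc k) = Step.step-universal l (tower l k) (tower-universal l k)

-- Ranks of a convex order

count : ∀ {n} → (Fin n → Bool) → ℕ
count {zero}  P = 0
count {suc n} P with P zero
... | true  = suc (count (P ∘ suc))
... | false = count (P ∘ suc)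

_⊆_ : ∀ {n} → (Fin n → Bool) → (Fin n → Bool) → Set
P ⊆ Q = ∀ x → P x ≡ true → Q x ≡ true

count-mono : ∀ {n} {P Q : Fin n → Bool} → P ⊆ Q → count P ≤ count Q
count-mono {zero}          P⊆Q = z≤n
count-mono {suc n} {P} {Q} P⊆Q with P zero in P0 | Q zero in Q0
... | true  | true  = s≤s (count-mono (P⊆Q ∘ suc))
... | false | true  = ℕ.m≤n⇒m≤1+n (count-mono (P⊆Q ∘ suc))
... | false | false = count-mono (P⊆Q ∘ suc)
... | true  | false = contradiction (P⊆Q zero P0) (not-¬ Q0)

count-strict : ∀ {n} {P Q : Fin n → Bool} → P ⊆ Q → ∀ x → P x ≡ false → Q x ≡ true → count P < count Q
count-strict P⊆Q zero Px Qx rewrite Px | Qx = s≤s (count-mono (P⊆Q ∘ suc))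
count-strict {P = P} {Q} P⊆Q (suc x) Px Qx with P zero in P0 | Q zero in Q0
... | true  | true  = s≤s (count-strict (P⊆Q ∘ suc) x Px Qx)
... | false | true  = ℕ.m≤n⇒m≤1+n (count-strict (P⊆Q ∘ suc) x Px Qx)
... | false | false = count-strict (P⊆Q ∘ suc) x Px Qx
... | true  | false = contradiction (P⊆Q zero P0) (not-¬ Q0)

count-all : ∀ n → count {n} (λ _ → true) ≡ n
count-all zero    = refl
count-all (suc n) = cong suc (count-all n)

count-bounded : ∀ {n} {P : Fin n → Bool} x → P x ≡ false → count P < n
count-bounded {n} {P} x Px = subst (count P <_) (count-all n) (count-strict (λ _ _ → refl) x Px refl)

abstract
  perp? : ∀ {m} (A : Rel₂ m) x y → Dec (Perp A x y)
  perp? A x y = (A x y Bool.≟ false) ×-dec (A y x Bool.≟ false)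

module Ranks {m} {A LA : Rel₂ m} (inAge : InAge A) (star : IsStarExpansion A LA) where
  A-asym = proj₂ (proj₁ inAge)
  perp-refl = proj₁ (proj₂ inAge)
  perp-sym = proj₁ (proj₂ (proj₂ inAge))
  perp-trans = proj₂ (proj₂ (proj₂ inAge))
  convex = proj₂ star

  LA-linear : StrictLinear LA
  LA-linear = record { irrefl = proj₁ (proj₁ star) ; transitive = proj₁ (proj₂ (proj₁ star)) ; total = proj₂ (proj₂ (proj₁ star)) }

  open StrictLinear LA-linear

  below : Fin m → Fin m → Bool
  below x z = LA z x

  belowPart : Fin m → Fin m → Bool
  belowPart x z = LA z x ∧ not (does (perp? A z x))

  belowPart-intro : ∀ {x z} → LA z x ≡ true → ¬ Perp A z x → belowPart x z ≡ true
  belowPart-intro {x} {z} z<x z⊥̸x rewrite z<x | dec-false (perp? A z x) z⊥̸x = refl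

  belowPart-elim : ∀ {x z} → belowPart x z ≡ true → LA z x ≡ true × ¬ Perp A z x
  belowPart-elim {x} {z} e with LA z x | perp? A z x
  ... | true | no z⊥̸x = refl , z⊥̸x

  belowPart-irrefl : ∀ x → belowPart x x ≡ false
  belowPart-irrefl x rewrite irrefl x = refl

  -- For `ρ` the points of earlier parts are counted rather than the parts, so its values may have
  -- gaps; no quotient by perpendicularity has to be formed.
  ρ σ : Fin m → ℕ
  ρ x = count (belowPart x)
  σ x = count (below x)

  σ-mono : ∀ {x y} → LA x y ≡ true → σ x < σ y
  σ-mono {x} {y} x<y = count-strict (λ z z<x → transitive z x y z<x x<y) x (irrefl x) x<y

  σ-reflects : ∀ {x y} → x ≢ y → σ x ≤ σ y → LA x y ≡ true
  σ-reflects {x} {y} x≢y σ≤ with total x y x≢y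
  ... | inj₁ x<y = x<y
  ... | inj₂ y<x = contradiction (≤-trans (σ-mono y<x) σ≤) (<-irrefl refl)

  -- If `z` is below `x` and outside its part, then `y` below `z` would give `y`, `z`, `x` in
  -- increasing order with perpendicular ends, and convexity would put `z` into the part.
  belowPart-perp : ∀ {x y} → Perp A x y → belowPart x ⊆ belowPart y
  belowPart-perp {x} {y} x⊥y z e with belowPart-elim {x} {z} e
  ... | z<x , z⊥̸x = belowPart-intro z<y z⊥̸y
    where
    z⊥̸y : ¬ Perp A z y
    z⊥̸y z⊥y = z⊥̸x (perp-trans z y x z⊥y (perp-sym x y x⊥y))

    z<y : LA z y ≡ true
    z<y with total z y (λ { refl → z⊥̸y (perp-refl z) })
    ... | inj₁ z<y = z<y
    ... | inj₂ y<z = contradiction (perp-sym y z (convex y z x y<z z<x (perp-sym x y x⊥y))) z⊥̸y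

  ρ-perp : ∀ {x y} → Perp A x y → ρ x ≡ ρ y
  ρ-perp {x} {y} x⊥y = ≤-antisym (count-mono (belowPart-perp x⊥y)) (count-mono (belowPart-perp (perp-sym x y x⊥y)))

  -- The point `x` itself makes the inclusion strict. For the inclusion, a `z` below `x` and
  -- perpendicular to `y` would be perpendicular to `x` by convexity.
  ρ-mono : ∀ {x y} → LA x y ≡ true → ¬ Perp A x y → ρ x < ρ y
  ρ-mono {x} {y} x<y x⊥̸y = count-strict sub x (belowPart-irrefl x) (belowPart-intro x<y x⊥̸y)
    where
    sub : belowPart x ⊆ belowPart y
    sub z e with belowPart-elim {x} {z} e
    ... | z<x , z⊥̸x = belowPart-intro (transitive z x y z<x x<y) (z⊥̸x ∘ convex z x y z<x x<y)

  ρ≡⇒perp : ∀ {x y} → ρ x ≡ ρ y → Perp A x y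
  ρ≡⇒perp {x} {y} eq with perp? A x y
  ... | yes x⊥y = x⊥y
  ... | no  x⊥̸y with total x y (λ { refl → x⊥̸y (perp-refl x) })
  ... | inj₁ x<y = contradiction (ρ-mono x<y x⊥̸y) (<-irrefl eq)
  ... | inj₂ y<x = contradiction (ρ-mono y<x (x⊥̸y ∘ perp-sym y x)) (<-irrefl (sym eq))

  ρ<⇒< : ∀ {x y} → ρ x < ρ y → LA x y ≡ true
  ρ<⇒< {x} {y} lt with total x y (λ { refl → <-irrefl refl lt })
  ... | inj₁ x<y = x<y
  ... | inj₂ y<x = contradiction (<-trans lt (ρ-mono y<x λ y⊥x → <-irrefl (sym (ρ-perp y⊥x)) lt)) (<-irrefl refl)

  ρ<⇒not : ∀ {x y} → ρ x < ρ y → A y x ≡ not (A x y)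
  ρ<⇒not {x} {y} lt with A x y in Axy | A y x in Ayx
  ... | true  | true  = trans (sym Ayx) (A-asym x y Axy)
  ... | true  | false = refl
  ... | false | true  = refl
  ... | false | false = contradiction lt (<-irrefl (ρ-perp (Axy , Ayx)))

  σ-injective : ∀ {x y} → σ x ≡ σ y → x ≡ y
  σ-injective {x} {y} eq with x Fin.≟ y
  ... | yes x≡y = x≡y
  ... | no  x≢y = contradiction (σ-mono (σ-reflects x≢y (ℕ.≤-reflexive eq))) (<-irrefl eq)

  ranking : Ranking m A
  ranking = record
    { ρ = ρ ; σ = σ
    ; σ-bounded   = λ x → count-bounded x (irrefl x)
    ; σ-injective = σ-injective
    ; ρ<⇒σ<       = σ-mono ∘ ρ<⇒<
    ; ρ≡⇒false    = proj₁ ∘ ρ≡⇒perp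
    ; ρ<⇒not      = ρ<⇒not
    }

  ρ-bounded : ∀ x → ρ x < m
  ρ-bounded x = count-bounded x (belowPart-irrefl x)

theorem8p6 : ExpansionProperty
theorem8p6 m A A-inAge = size , B , B-inAge , embeds
  where
  -- Both parameters are `m`: `σ` and `ρ` are counts that omit the point itself, so word length `m`
  -- and height `m` suffice.
  open Structure (tower m m)
  open Finite carrier-finite
  module M = Multipartite multipartite

  B : Rel₂ size
  B a b = E (elem a) (elem b)

  B-inAge : InAge B
  B-inAge =
    ((λ a → M.irrefl _) , (λ a b → M.asym _ _)) ,
    (λ a → M.irrefl _ , M.irrefl _) ,
    (λ a b (p , q) → q , p) ,
    (λ a b c → M.perp-trans _ _ _)

  embeds : ∀ LA → IsStarExpansion A LA → ∀ LB → IsStarExpansion B LB → Embeds A LA B LB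
  embeds LA LA-star LB ((LB-irrefl , LB-trans , LB-total) , LB-convex) = g , g-injective , g-edge , g-order
    where
    open Ranks A-inAge LA-star
    module LA = StrictLinear LA-linear

    LB-order : ConvexOrder B LB
    LB-order = record
      { linear = record { irrefl = LB-irrefl ; transitive = LB-trans ; total = LB-total }
      ; convex = LB-convex
      }
    module LB = ConvexOrder LB-order

    -- The order `LB` lives on indices and is transported to the carrier, where universality
    -- applies.
    embedding = tower-universal m m (λ u v → LB (index u) (index v))
      (pullback-convex index index-injective (λ u v → cong₂ E (elem-index u) (elem-index v)) LB-order) ranking

    f : Fin m → Carrier
    f = proj₁ embedding

    g : Fin m → Fin size
    g = index ∘ f

    g-edge : ∀ x y → B (g x) (g y) ≡ A x y
    g-edge x y = trans (cong₂ E (elem-index (f x)) (elem-index (f y)))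
                       (proj₁ (proj₂ embedding x y (ρ-bounded x) (ρ-bounded y)))

    g-mono : ∀ x y → LA x y ≡ true → LB (g x) (g y) ≡ true
    g-mono x y x<y = proj₂ (proj₂ embedding x y (ρ-bounded x) (ρ-bounded y)) (σ-mono x<y)

    g-injective : ∀ {x y} → g x ≡ g y → x ≡ y
    g-injective {x} {y} eq with x Fin.≟ y
    ... | yes x≡y = x≡y
    ... | no  x≢y with LA.total x y x≢y
    ... | inj₁ x<y = contradiction eq (LB.<⇒≢ (g-mono x y x<y))
    ... | inj₂ y<x = contradiction (sym eq) (LB.<⇒≢ (g-mono y x y<x))

    -- Monotonicity is enough: `LA` is total, and asymmetry of both orders settles the reversed
    -- pairs.
    g-order : ∀ x y → LB (g x) (g y) ≡ LA x y
    g-order x y with x Fin.≟ y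
    ... | yes refl = trans (LB.irrefl (g x)) (sym (LA.irrefl x))
    ... | no  x≢y with LA.total x y x≢y
    ... | inj₁ x<y = trans (g-mono x y x<y) (sym x<y)
    ... | inj₂ y<x = trans (LB.asym (g y) (g x) (g-mono y x y<x)) (sym (LA.asym y x y<x))
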